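{- Let $N\ge 5$ be an integer. The supremum $\sup_{E\in\mathcal{T}^N_3}P^N_s(E)$ is realised by the trunk graph whose associated sequence is $$\left(1,1,\left\lfloor \tfrac N3\right\rfloor-1\right)\ \text{ if } N\equiv 0 \pmod 3,\qquad \left(1,3,\left\lfloor \tfrac N3\right\rfloor-2\right)\ \text{ if } N\equiv 1\pmod 3,\qquad \left(1,2,\left\lfloor \tfrac N3\right\rfloor-1\right)\ \text{ if } N\equiv 2\pmod 3.$$
   Context: A trunk graph with $N$ edges is a directed graph with vertices $v_1,\dots,v_n$ ($n\ge2$) such that every edge goes from some $v_i$ to $v_{i+1}$, there are $m_i\ge1$ edges from $v_i$ to $v_{i+1}$ for each $1\le i\le n-1$, and $m_1+\dots+m_{n-1}=N$. It is written $(m_1,\dots,m_{n-1})$. $\mathcal{T}^N_3$ is the set of trunk graphs with $N$ edges and all $m_i\le 3$. A trunk graph has associated sequence $(n_1,n_2,n_3)$ (with $n_1,n_2,n_3\ge0$) if $(m_1,\dots,m_{n-1})$ consists of $n_1$ ones, followed by $n_2$ twos, followed by $n_3$ threes. $P^N_s(E)$ is the number of finite directed paths in $E$ (including the path of length $0$) ending at the unique sink $v_n$. -}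

module Defs where

open import Data.Empty using (⊥; ⊥-elim)
open import Data.Fin.Base using (Fin; zero; suc; inject₁; fromℕ)
open import Data.Fin.Properties using (1↔⊤; +↔⊎; *↔×)
open import Data.List.Base using (List; []; _∷_; _++_; length; lookup; replicate)
open import Data.List.Relation.Unary.All using (All)
open import Data.Nat.ListAction using (sum)
open import Data.Nat.Base using (ℕ; suc; _+_; _*_; _≤_)
open import Data.Product.Base using (Σ-syntax; ∃-syntax; _×_; _,_; proj₁; proj₂)
open import Data.Product.Function.NonDependent.Propositional using (_×-↔_)
open import Data.Sum.Base using (_⊎_; inj₁; inj₂)
open import Data.Sum.Function.Propositional using (_⊎-↔_)
open import Data.Unit.Base using (tt)
open import Function.Base using (_∘_)
open import Function.Bundles using (_↔_; mk↔ₛ′)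
open import Function.Construct.Composition using (_↔-∘_)
open import Function.Construct.Identity using (↔-id)
open import Function.Construct.Symmetry using (↔-sym)
open import Level using (0ℓ)
open import Relation.Binary.Construct.Closure.ReflexiveTransitive using (Star; ε; _◅_; gmap)
open import Relation.Binary.PropositionalEquality using (_≡_; refl; cong; subst₂)
open import Relation.Unary using (Pred; _∈_)

-- The underlying data of a trunk graph on vertices v₁, …, vₙ: the list
-- (m₁, …, mₙ₋₁), so that n = suc (length ms).

Vertex : List ℕ → Set
Vertex ms = Fin (suc (length ms))

data Edge (ms : List ℕ) : Vertex ms → Vertex ms → Set where
  edge : (i : Fin (length ms)) → Fin (lookup ms i) → Edge ms (inject₁ i) (suc i)

sink : (ms : List ℕ) → Vertex ms
sink ms = fromℕ (length ms)

-- A directed path is a possibly empty chain of composable edges. Being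
-- proof-relevant, `Star` distinguishes paths through different parallel edges.

Path : (ms : List ℕ) → Vertex ms → Vertex ms → Set
Path ms = Star (Edge ms)

PathsToSink : List ℕ → Set
PathsToSink ms = Σ[ v ∈ Vertex ms ] Path ms v (sink ms)

record TrunkGraph : Set where
  field
    multiplicities : List ℕ
    2≤n            : 2 ≤ suc (length multiplicities)
    1≤mᵢ           : All (1 ≤_) multiplicities

open TrunkGraph public

-- PathsToSink ms is finite. A path to the sink of (m ∷ ms) either starts at the
-- first vertex, and is then one of m edges followed by a path from the first
-- vertex of the trunk graph ms, or it lies entirely in that smaller graph.

module _ {m : ℕ} {ms : List ℕ} where

  raiseEdge : ∀ {u v} → Edge ms u v → Edge (m ∷ ms) (suc u) (suc v)
  raiseEdge (edge i k) = edge (suc i) k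

  raise : ∀ {u v} → Path ms u v → Path (m ∷ ms) (suc u) (suc v)
  raise = gmap suc raiseEdge

  lower : ∀ {u′ v′} → Path (m ∷ ms) u′ v′ →
          ∀ {u v} → u′ ≡ suc u → v′ ≡ suc v → Path ms u v
  lower ε                   refl refl = ε
  lower (edge zero _ ◅ _)    ()
  lower (edge (suc i) k ◅ p) refl eq = edge i k ◅ lower p refl eq

  raise-lower : ∀ {u′ v′} (p : Path (m ∷ ms) u′ v′) →
                ∀ {u v} (eq₁ : u′ ≡ suc u) (eq₂ : v′ ≡ suc v) →
                raise (lower p eq₁ eq₂) ≡ subst₂ (Path (m ∷ ms)) eq₁ eq₂ p
  raise-lower ε                   refl refl = refl
  raise-lower (edge zero _ ◅ _)    ()
  raise-lower (edge (suc i) k ◅ p) refl refl =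
    cong (edge (suc i) k ◅_) (raise-lower p refl refl)

  lower-raise : ∀ {u v} (p : Path ms u v) → lower (raise p) refl refl ≡ p
  lower-raise ε                = refl
  lower-raise (edge i k ◅ p) = cong (edge i k ◅_) (lower-raise p)

  pathFromFirst : Fin m × Path ms zero (sink ms) → Path (m ∷ ms) zero (suc (sink ms))
  pathFromFirst (k , p) = edge zero k ◅ raise p

  unPathFromFirst : ∀ {u w} → Path (m ∷ ms) u w → u ≡ zero → w ≡ suc (sink ms) →
                    Fin m × Path ms zero (sink ms)
  unPathFromFirst ε                    refl ()
  unPathFromFirst (edge zero k ◅ p)    _    eq = k , lower p refl eq
  unPathFromFirst (edge (suc _) _ ◅ _) ()

  pathFromFirst-un : ∀ {u w} (p : Path (m ∷ ms) u w) (eq₁ : u ≡ zero) (eq₂ : w ≡ suc (sink ms)) →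
                     pathFromFirst (unPathFromFirst p eq₁ eq₂) ≡ subst₂ (Path (m ∷ ms)) eq₁ eq₂ p
  pathFromFirst-un ε                    refl ()
  pathFromFirst-un (edge zero k ◅ p)    refl refl = cong (edge zero k ◅_) (raise-lower p refl refl)
  pathFromFirst-un (edge (suc _) _ ◅ _) ()

  fromFirst↔ : Path (m ∷ ms) zero (suc (sink ms)) ↔ (Fin m × Path ms zero (sink ms))
  fromFirst↔ = mk↔ₛ′
    (λ p → unPathFromFirst p refl refl)
    pathFromFirst
    (λ { (k , p) → cong (k ,_) (lower-raise p) })
    (λ p → pathFromFirst-un p refl refl)

  toSink↔ : PathsToSink (m ∷ ms) ↔ (Path (m ∷ ms) zero (suc (sink ms)) ⊎ PathsToSink ms)
  toSink↔ = mk↔ₛ′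
    (λ { (zero , p) → inj₁ p ; (suc u , p) → inj₂ (u , lower p refl refl) })
    (λ { (inj₁ p) → zero , p ; (inj₂ (u , p)) → suc u , raise p })
    (λ { (inj₁ p) → refl ; (inj₂ (u , p)) → cong (inj₂ ∘ (u ,_)) (lower-raise p) })
    (λ { (zero , p) → refl ; (suc u , p) → cong (suc u ,_) (raise-lower p refl refl) })

Finite : Set → Set
Finite A = ∃[ k ] (A ↔ Fin k)

fromFirst-finite : (ms : List ℕ) → Finite (Path ms zero (sink ms))
fromFirst-finite [] = 1 , ↔-sym 1↔⊤ ↔-∘ mk↔ₛ′ (λ _ → tt) (λ _ → ε) (λ _ → refl) unique
  where
  unique : (p : Path [] zero zero) → ε ≡ p
  unique ε                    = refl
  unique (_◅_ {j = zero} e _) = ⊥-elim (noEdge e)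
    where
    noEdge : ∀ {u v} → Edge [] u v → ⊥
    noEdge (edge () _)
fromFirst-finite (m ∷ ms) =
  let k , paths↔ = fromFirst-finite ms in
  m * k , ↔-sym *↔× ↔-∘ ((↔-id (Fin m) ×-↔ paths↔) ↔-∘ fromFirst↔)

pathsToSink-finite : (ms : List ℕ) → Finite (PathsToSink ms)
pathsToSink-finite [] =
  let k , paths↔ = fromFirst-finite [] in
  k , paths↔ ↔-∘ mk↔ₛ′
    (λ { (zero , p) → p ; (suc () , _) }) (zero ,_) (λ _ → refl)
    (λ { (zero , _) → refl ; (suc () , _) })
pathsToSink-finite (m ∷ ms) =
  let k , first↔ = fromFirst-finite (m ∷ ms)
      l , rest↔  = pathsToSink-finite ms
  in k + l , ↔-sym +↔⊎ ↔-∘ ((first↔ ⊎-↔ rest↔) ↔-∘ toSink↔)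

-- The cardinality of the set of paths ending at the sink.

Pₛ : TrunkGraph → ℕ
Pₛ E = proj₁ (pathsToSink-finite (multiplicities E))

Pₛ-counts : (E : TrunkGraph) → PathsToSink (multiplicities E) ↔ Fin (Pₛ E)
Pₛ-counts E = proj₂ (pathsToSink-finite (multiplicities E))

𝒯₃ : ℕ → Pred TrunkGraph 0ℓ
𝒯₃ N E = sum (multiplicities E) ≡ N × All (_≤ 3) (multiplicities E)

HasAssociatedSequence : TrunkGraph → ℕ × ℕ × ℕ → Set
HasAssociatedSequence E (n₁ , n₂ , n₃) =
  multiplicities E ≡ replicate n₁ 1 ++ replicate n₂ 2 ++ replicate n₃ 3

IsSupremum : Pred ℕ 0ℓ → ℕ → Set
IsSupremum S p = (∀ q → q ∈ S → q ≤ p) × (∀ b → (∀ q → q ∈ S → q ≤ b) → p ≤ b)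

RealisesSupremum : ℕ → TrunkGraph → Set
RealisesSupremum N E =
  E ∈ 𝒯₃ N × IsSupremum (λ q → ∃[ F ] (F ∈ 𝒯₃ N × Pₛ F ≡ q)) (Pₛ E)

{-# OPTIONS --safe #-}
-- Appending m edges at the sink turns a count p into 1 + m p, so Pₛ is evaluated
-- by Horner's rule starting from 1. This map is monotone in p, so the largest
-- count f satisfies f N = max (1 + m f (N - m)) over m = 1, 2, 3. For N ≥ 8 the
-- maximum is always attained at m = 3: the inequality 1 + m x ≤ y is
-- preserved when x and y are replaced by 1 + 3 x and 1 + 3 y, because m ≤ 3.
-- The three families in the theorem are the optimal lists for 5, 6 and 7 edges
-- followed by threes.
module Submission where

open import Defs
open import Data.List.Base using (List; []; _∷_; _++_; foldl; replicate)
open import Data.List.Relation.Unary.All using (All; []; _∷_; all?)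
open import Data.List.Relation.Unary.All.Properties using (++⁺; replicate⁺)
open import Data.List.Properties using (foldl-++)
open import Data.Nat.Base using (ℕ; suc; _+_; _*_; _≤_; _∸_; z≤n; s≤s)
open import Data.Nat.DivMod using (_/_; _%_; m≡m%n+[m/n]*n)
open import Data.Nat.ListAction using (sum)
open import Data.Nat.ListAction.Properties using (sum-++)
open import Data.Nat.Properties
open import Algebra.Properties.CommutativeSemigroup +-commutativeSemigroup using (x∙yz≈y∙xz; xy∙z≈xz∙y; xy∙z≈y∙xz)
open import Data.Nat.Tactic.RingSolver using (solve-∀)
open import Data.Product.Base using (_×_; _,_; ∃-syntax; proj₁)
open import Relation.Binary.PropositionalEquality
  using (_≡_; refl; sym; trans; cong; module ≡-Reasoning)
open import Relation.Nullary.Decidable using (True; toWitness)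

paths : List ℕ → ℕ
paths ms = proj₁ (pathsToSink-finite ms)

pathsFromFirst : List ℕ → ℕ
pathsFromFirst ms = proj₁ (fromFirst-finite ms)

horner : ℕ → List ℕ → ℕ
horner = foldl (λ a m → suc (m * a))

-- The summand pathsFromFirst ms on the left avoids a subtraction on the right.
horner-paths : ∀ a ms →
  horner a ms + pathsFromFirst ms ≡ pathsFromFirst ms * a + paths ms
horner-paths a []       = cong (_+ 1) (sym (*-identityˡ a))
horner-paths a (m ∷ ms) = step _ _ _ (horner-paths (suc (m * a)) ms)
  where
  open ≡-Reasoning

  expand : ∀ m a q p → q * suc (m * a) + p + m * q ≡ m * q * a + (m * q + p) + q
  expand = solve-∀

  step : ∀ h q p → h + q ≡ q * suc (m * a) + p → h + m * q ≡ m * q * a + (m * q + p)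
  step h q p ih = +-cancelʳ-≡ q _ _ (begin
    h + m * q + q                ≡⟨ xy∙z≈xz∙y h (m * q) q ⟩
    h + q + m * q                ≡⟨ cong (_+ m * q) ih ⟩
    q * suc (m * a) + p + m * q  ≡⟨ expand m a q p ⟩
    m * q * a + (m * q + p) + q  ∎)

paths≡horner : ∀ ms → paths ms ≡ horner 1 ms
paths≡horner ms = +-cancelˡ-≡ q _ _ (begin
  q + paths ms        ≡⟨ cong (_+ paths ms) (*-identityʳ q) ⟨
  q * 1 + paths ms    ≡⟨ horner-paths 1 ms ⟨
  horner 1 ms + q     ≡⟨ +-comm (horner 1 ms) q ⟩
  q + horner 1 ms     ∎)
  where
  open ≡-Reasoning
  q = pathsFromFirst ms

pattern 5+_ n = suc (suc (suc (suc (suc n))))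

maxPaths : ℕ → ℕ
maxPaths 0 = 1
maxPaths 1 = 2
maxPaths 2 = 3
maxPaths 3 = 5
maxPaths 4 = 7
maxPaths 5 = 11
maxPaths 6 = 16
maxPaths 7 = 23
maxPaths (suc (suc (suc (5+ n)))) = suc (3 * maxPaths (5+ n))

maxPaths-step : ∀ n {m} → m ≤ 3 → suc (m * maxPaths n) ≤ maxPaths (n + m)
maxPaths-step n {m} m≤3 = go n
  where
  byComputation : ∀ n {_ : True (allUpTo? (λ m → suc (m * maxPaths n) ≤? maxPaths (n + m)) 4)} →
                  suc (m * maxPaths n) ≤ maxPaths (n + m)
  byComputation n {t} = toWitness t (s≤s m≤3)

  m*[1+3*x] : ∀ m x → m * suc (3 * x) ≡ m + 3 * (m * x)
  m*[1+3*x] = solve-∀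

  go : ∀ n → suc (m * maxPaths n) ≤ maxPaths (n + m)
  go 0 = byComputation 0
  go 1 = byComputation 1
  go 2 = byComputation 2
  go 3 = byComputation 3
  go 4 = byComputation 4
  go 5 = byComputation 5
  go 6 = byComputation 6
  go 7 = byComputation 7
  go (suc (suc (suc (5+ n)))) = s≤s (begin
    m * suc (3 * x)          ≡⟨ m*[1+3*x] m x ⟩
    m + 3 * (m * x)          ≤⟨ +-monoˡ-≤ (3 * (m * x)) m≤3 ⟩
    3 + 3 * (m * x)          ≡⟨ *-suc 3 (m * x) ⟨
    3 * suc (m * x)          ≤⟨ *-monoʳ-≤ 3 (go (5+ n)) ⟩
    3 * maxPaths (5+ n + m)  ∎)
    where
    open ≤-Reasoning
    x = maxPaths (5+ n)

horner≤maxPaths : ∀ {a} n {ms} → a ≤ maxPaths n → All (_≤ 3) ms →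
                  horner a ms ≤ maxPaths (n + sum ms)
horner≤maxPaths n a≤ [] rewrite +-identityʳ n = a≤
horner≤maxPaths n {m ∷ ms} a≤ (m≤3 ∷ ms≤3) rewrite sym (+-assoc n m (sum ms)) =
  horner≤maxPaths (n + m)
    (≤-trans (s≤s (*-monoʳ-≤ m a≤)) (maxPaths-step n m≤3)) ms≤3

maxPaths-3+ : ∀ {n} → 5 ≤ n → maxPaths (3 + n) ≡ suc (3 * maxPaths n)
maxPaths-3+ (s≤s (s≤s (s≤s (s≤s (s≤s z≤n))))) = refl

horner-threes : ∀ n k → 5 ≤ n →
                horner (maxPaths n) (replicate k 3) ≡ maxPaths (k * 3 + n)
horner-threes n 0       5≤n = refl
horner-threes n (suc k) 5≤n = begin
  horner (suc (3 * maxPaths n)) threes  ≡⟨ cong (λ a → horner a threes) (maxPaths-3+ 5≤n) ⟨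
  horner (maxPaths (3 + n)) threes      ≡⟨ horner-threes (3 + n) k (≤-trans 5≤n (m≤n+m n 3)) ⟩
  maxPaths (k * 3 + (3 + n))            ≡⟨ cong maxPaths (x∙yz≈y∙xz (k * 3) 3 n) ⟩
  maxPaths (suc k * 3 + n)              ∎
  where
  open ≡-Reasoning
  threes = replicate k 3

sum-threes : ∀ k → sum (replicate k 3) ≡ k * 3
sum-threes 0       = refl
sum-threes (suc k) = cong (3 +_) (sum-threes k)

realises-maximum : ∀ {N} E → 𝒯₃ N E → Pₛ E ≡ maxPaths N → RealisesSupremum N E
realises-maximum {N} E E∈𝒯₃ attained = E∈𝒯₃ , bounds , λ b b-bounds → b-bounds (Pₛ E) (E , E∈𝒯₃ , refl)
  where
  open ≤-Reasoning
  bounds : ∀ q → ∃[ F ] (𝒯₃ N F × Pₛ F ≡ q) → q ≤ Pₛ E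
  bounds q (F , (refl , F≤3) , refl) = begin
    Pₛ F                              ≡⟨ paths≡horner (multiplicities F) ⟩
    horner 1 (multiplicities F)       ≤⟨ horner≤maxPaths 0 ≤-refl F≤3 ⟩
    maxPaths (sum (multiplicities F)) ≡⟨ attained ⟨
    Pₛ E                              ∎

threes-realise : ∀ {N} m ms k →
  {_ : True (all? (1 ≤?_) (m ∷ ms))} {_ : True (all? (_≤? 3) (m ∷ ms))}
  {_ : True (5 ≤? sum (m ∷ ms))} →
  horner 1 (m ∷ ms) ≡ maxPaths (sum (m ∷ ms)) → N ≡ k * 3 + sum (m ∷ ms) →
  ∃[ E ] (multiplicities E ≡ m ∷ ms ++ replicate k 3 × RealisesSupremum N E)
threes-realise m ms k {1≤} {≤3} {5≤} optimal refl =
  E , refl , realises-maximum E (sum≡ , ++⁺ (toWitness ≤3) (replicate⁺ k ≤-refl)) attained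
  where
  open ≡-Reasoning
  n = sum (m ∷ ms)

  E : TrunkGraph
  E = record
    { multiplicities = m ∷ ms ++ replicate k 3
    ; 2≤n            = s≤s (s≤s z≤n)
    ; 1≤mᵢ           = ++⁺ (toWitness 1≤) (replicate⁺ k (s≤s z≤n))
    }

  sum≡ : sum (multiplicities E) ≡ k * 3 + n
  sum≡ = begin
    sum (multiplicities E)     ≡⟨ sum-++ (m ∷ ms) (replicate k 3) ⟩
    n + sum (replicate k 3)    ≡⟨ cong (n +_) (sum-threes k) ⟩
    n + k * 3                  ≡⟨ +-comm n (k * 3) ⟩
    k * 3 + n                  ∎

  attained : Pₛ E ≡ maxPaths (k * 3 + n)
  attained = begin
    Pₛ E                                          ≡⟨ paths≡horner (multiplicities E) ⟩
    horner 1 (multiplicities E)                   ≡⟨ foldl-++ _ 1 (m ∷ ms) (replicate k 3) ⟩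
    horner (horner 1 (m ∷ ms)) (replicate k 3)    ≡⟨ cong (λ a → horner a (replicate k 3)) optimal ⟩
    horner (maxPaths n) (replicate k 3)           ≡⟨ horner-threes n k (toWitness 5≤) ⟩
    maxPaths (k * 3 + n)                          ∎

theorem4p11 : (N : ℕ) → 5 ≤ N →
    (N % 3 ≡ 0 → ∃[ E ] (HasAssociatedSequence E (1 , 1 , N / 3 ∸ 1) × RealisesSupremum N E)) ×
    (N % 3 ≡ 1 → ∃[ E ] (HasAssociatedSequence E (1 , 3 , N / 3 ∸ 2) × RealisesSupremum N E)) ×
    (N % 3 ≡ 2 → ∃[ E ] (HasAssociatedSequence E (1 , 2 , N / 3 ∸ 1) × RealisesSupremum N E))
theorem4p11 N 5≤N =
    (λ r → residue0 (N / 3) (division r) 5≤N)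
  , (λ r → residue1 (N / 3) (division r) 5≤N)
  , (λ r → residue2 (N / 3) (division r) 5≤N)
  where
  division : ∀ {r} → N % 3 ≡ r → N ≡ N / 3 * 3 + r
  division refl = trans (m≡m%n+[m/n]*n N 3) (+-comm (N % 3) (N / 3 * 3))

  shift : ∀ {M r} j k → M ≡ (j + k) * 3 + r → M ≡ k * 3 + (j * 3 + r)
  shift {r = r} j k refl = trans (cong (_+ r) (*-distribʳ-+ 3 j k)) (xy∙z≈y∙xz (j * 3) (k * 3) r)

  residue0 : ∀ {M} q → M ≡ q * 3 + 0 → 5 ≤ M →
             ∃[ E ] (HasAssociatedSequence E (1 , 1 , q ∸ 1) × RealisesSupremum M E)
  residue0 0             refl ()
  residue0 1             refl (s≤s (s≤s (s≤s ())))
  residue0 (suc (suc k)) eq   _ = threes-realise 1 (2 ∷ 3 ∷ []) k refl (shift 2 k eq)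

  residue1 : ∀ {M} q → M ≡ q * 3 + 1 → 5 ≤ M →
             ∃[ E ] (HasAssociatedSequence E (1 , 3 , q ∸ 2) × RealisesSupremum M E)
  residue1 0             refl (s≤s ())
  residue1 1             refl (s≤s (s≤s (s≤s (s≤s ()))))
  residue1 (suc (suc k)) eq   _ = threes-realise 1 (2 ∷ 2 ∷ 2 ∷ []) k refl (shift 2 k eq)

  residue2 : ∀ {M} q → M ≡ q * 3 + 2 → 5 ≤ M →
             ∃[ E ] (HasAssociatedSequence E (1 , 2 , q ∸ 1) × RealisesSupremum M E)
  residue2 0       refl (s≤s (s≤s ()))
  residue2 (suc k) eq   _ = threes-realise 1 (2 ∷ 2 ∷ []) k refl (shift 1 k eq)
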